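{- Assume Martin's Axiom MA together with the negation of the Continuum Hypothesis ($2^{\aleph_0}>\aleph_1$). Let $\mathfrak B$ be an atomless Boolean algebra with $|\mathfrak B|<2^{\aleph_0}$. Then the following are equivalent: (1) $\mathfrak B$ satisfies the countable chain condition (every family of pairwise disjoint nonzero elements of $\mathfrak B$ is countable); (2) there is a decomposition $\mathfrak B\setminus\{0\}=\bigcup_{n<\omega}\mathfrak B_n$ such that for each $n<\omega$: $\mathfrak B_n\subseteq\mathfrak B_{n+1}$; $\mathrm{int}(\mathfrak B_n)\ge 2^{ -n}$; and for every $a\in\mathfrak B_n$ there are disjoint $b,c\in\mathfrak B_{n+1}$ with $b\vee c\le a$.
   Context: A Boolean algebra is atomless if it has no atom, i.e. no nonzero element $a$ whose only elements below it are $0$ and $a$. Elements $b,c$ are disjoint if $b\wedge c=0$. For a family $\mathcal F\subseteq\mathfrak B\setminus\{0\}$, the intersection number $\mathrm{int}(\mathcal F)$ is the supremum of all $\alpha\ge0$ such that for every finite sequence $a_1,\dots,a_m$ of elements of $\mathcal F$ (repetitions allowed) there is a set $I\subseteq\{1,\dots,m\}$ with $|I|\ge\alpha m$ and $\bigwedge_{i\in I}a_i\ne 0$. MA is Martin's Axiom: for every partial order $\mathbf P$ with no uncountable family of pairwise incompatible elements and every family of fewer than $2^{\aleph_0}$ dense subsets of $\mathbf P$, there is a filter on $\mathbf P$ meeting all of them. -}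

module Defs where

open import Algebra.Lattice.Bundles using (BooleanAlgebra)
import Algebra.Lattice.Properties.BooleanAlgebra as BooleanAlgebraProperties
open import Data.Bool.Base using (Bool; if_then_else_)
open import Data.Fin.Base using (Fin)
open import Data.Fin.Subset using (Subset; ∣_∣)
open import Data.Integer.Base using (+_)
open import Data.Nat.Base as ℕ using (ℕ; suc)
open import Data.Nat.Properties using (m^n≢0)
open import Data.Product.Base using (Σ; ∃; ∃-syntax; _×_; proj₁)
open import Data.Rational.Base as ℚ using (ℚ; 0ℚ; _/_)
open import Data.Sum.Base using (_⊎_)
import Data.Vec.Base as Vec
open import Data.Vec.Functional using (Vector; foldr)
open import Function.Bundles using (Func; Injection; Surjection; _⇔_)
open import Induction.WellFounded using (WellFounded)
open import Level using (Level; 0ℓ)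
open import Relation.Binary.Bundles using (Setoid; Poset; StrictTotalOrder)
open import Relation.Binary.Definitions using (_Respects_)
import Relation.Binary.Construct.On as On
open import Relation.Binary.PropositionalEquality as ≡ using (_→-setoid_)
open import Relation.Nullary using (¬_)
open import Relation.Unary using (Pred)

-- Sets are rendered as setoids, so that an element of a structure is an
-- element of its carrier up to _≈_; subsets, maps and cardinalities are
-- accordingly all taken up to _≈_.

-- The axiom of choice of the ambient set theory: every surjection of sets
-- has a section.  The section must respect _≈_, so this does not follow from
-- the type-theoretic reading of ∃.

AxiomOfChoice : ∀ ℓ → Set (Level.suc ℓ)
AxiomOfChoice ℓ = {S T : Setoid ℓ ℓ} (f : Surjection S T) →
  let open Setoid T using (_≈_) in
  Σ (Func T S) λ g → ∀ y → Surjection.to f (Func.to g y) ≈ y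

------------------------------------------------------------------------
-- Subsets and cardinality

record SubsetOf (S : Setoid 0ℓ 0ℓ) : Set₁ where
  open Setoid S using (Carrier; _≈_)
  field
    member : Pred Carrier 0ℓ
    resp   : member Respects _≈_

infix 4 _∈_ _⊆_

_∈_ : {S : Setoid 0ℓ 0ℓ} → Setoid.Carrier S → SubsetOf S → Set
x ∈ A = SubsetOf.member A x

_⊆_ : {S : Setoid 0ℓ 0ℓ} → SubsetOf S → SubsetOf S → Set
A ⊆ B = ∀ {x} → x ∈ A → x ∈ B

restrict : (S : Setoid 0ℓ 0ℓ) → Pred (Setoid.Carrier S) 0ℓ → Setoid 0ℓ 0ℓ
restrict S P = On.setoid {B = Σ (Setoid.Carrier S) P} S proj₁

subsetoid : {S : Setoid 0ℓ 0ℓ} → SubsetOf S → Setoid 0ℓ 0ℓ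
subsetoid {S} A = restrict S (SubsetOf.member A)

-- At most countable: finite sets are included.
Countable : Setoid 0ℓ 0ℓ → Set
Countable S = Injection S (≡.setoid ℕ)

Uncountable : Setoid 0ℓ 0ℓ → Set
Uncountable S = ¬ Countable S

infix 4 _≺_

_≺_ : Setoid 0ℓ 0ℓ → Setoid 0ℓ 0ℓ → Set
S ≺ T = Injection S T × ¬ Injection T S

-- The power set of ℕ; its equality is pointwise.
Continuum : Setoid 0ℓ 0ℓ
Continuum = ℕ →-setoid Bool

------------------------------------------------------------------------
-- Martin's Axiom and the negation of the Continuum Hypothesis

module _ (P : Poset 0ℓ 0ℓ 0ℓ) where
  open Poset P using (Carrier; _≈_; _≤_; module Eq)

  Compatible : Carrier → Carrier → Set
  Compatible p q = ∃[ r ] r ≤ p × r ≤ q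

  PairwiseIncompatible : SubsetOf Eq.setoid → Set
  PairwiseIncompatible A =
    ∀ {p q} → p ∈ A → q ∈ A → ¬ p ≈ q → ¬ Compatible p q

  NoUncountableAntichain : Set₁
  NoUncountableAntichain =
    ¬ (∃[ A ] PairwiseIncompatible A × Uncountable (subsetoid A))

  Dense : SubsetOf Eq.setoid → Set
  Dense D = ∀ p → ∃[ q ] q ∈ D × q ≤ p

  record IsFilter (G : SubsetOf Eq.setoid) : Set where
    field
      nonempty : ∃[ p ] p ∈ G
      upward   : ∀ {p q} → p ∈ G → p ≤ q → q ∈ G
      directed : ∀ {p q} → p ∈ G → q ∈ G → ∃[ r ] r ∈ G × r ≤ p × r ≤ q

-- Partial orders are nonempty by convention (the empty one has no filter).
-- The family of dense sets is indexed by a set I with |I| < 2^ℵ₀.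
MartinsAxiom : Set₁
MartinsAxiom =
  (P : Poset 0ℓ 0ℓ 0ℓ) → let module P = Poset P in
  P.Carrier →
  NoUncountableAntichain P →
  (I : Setoid 0ℓ 0ℓ) → let module I = Setoid I in
  I ≺ Continuum →
  (D : I.Carrier → SubsetOf P.Eq.setoid) →
  (∀ {i j} → i I.≈ j → D i ⊆ D j) →
  (∀ i → Dense P (D i)) →
  ∃[ G ] IsFilter P G × (∀ i → ∃[ p ] p ∈ G × p ∈ D i)

-- W has order type ω₁, hence cardinality ℵ₁.
record IsOmega₁ (W : StrictTotalOrder 0ℓ 0ℓ 0ℓ) : Set where
  open StrictTotalOrder W using (_<_; module Eq)
  field
    wellFounded      : WellFounded _<_
    uncountable      : Uncountable Eq.setoid
    countableInitial : ∀ w → Countable (restrict Eq.setoid (_< w))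

-- 2^ℵ₀ > ℵ₁.
¬CH : Set₁
¬CH = ∃[ W ] IsOmega₁ W × StrictTotalOrder.Eq.setoid W ≺ Continuum

------------------------------------------------------------------------
-- Boolean algebras

2^-_ : ℕ → ℚ
2^- n = _/_ (+ 1) (2 ℕ.^ n) {{m^n≢0 2 n}}

module _ (𝔅 : BooleanAlgebra 0ℓ 0ℓ) where
  open BooleanAlgebra 𝔅 using (Carrier; _≈_; _∧_; _∨_; ⊤; ⊥; setoid)
  open Poset (BooleanAlgebraProperties.poset 𝔅) using (_≤_)

  IsAtom : Carrier → Set
  IsAtom a = ¬ a ≈ ⊥ × (∀ b → b ≤ a → b ≈ ⊥ ⊎ b ≈ a)

  Atomless : Set
  Atomless = ¬ ∃ IsAtom

  Disjoint : Carrier → Carrier → Set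
  Disjoint b c = b ∧ c ≈ ⊥

  CCC : Set₁
  CCC = (A : SubsetOf setoid) →
    (∀ {a} → a ∈ A → ¬ a ≈ ⊥) →
    (∀ {a b} → a ∈ A → b ∈ A → ¬ a ≈ b → Disjoint a b) →
    Countable (subsetoid A)

  ⋀ : ∀ {m} → Subset m → Vector Carrier m → Carrier
  ⋀ I a = foldr _∧_ ⊤ (λ i → if Vec.lookup I i then a i else ⊤)

  -- The condition on α whose supremum over α ≥ 0 is int(F).  Sequences have
  -- length m ≥ 1; m = 0 would add only the requirement that ⊤ be nonzero.
  Admissible : SubsetOf setoid → ℚ → Set
  Admissible F α = ∀ {m} → 0 ℕ.< m → (a : Vector Carrier m) →
    (∀ i → a i ∈ F) →
    Σ (Subset m) λ I →
      (α ℚ.* (+ m / 1) ℚ.≤ + ∣ I ∣ / 1) × ¬ ⋀ I a ≈ ⊥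

  -- The real number int(F) is given by its lower Dedekind cut: q < int(F)
  -- iff q lies below some admissible α ≥ 0.  Admissibility is inherited by
  -- smaller α, so rational α give the same supremum as real ones.
  _<int_ : ℚ → SubsetOf setoid → Set
  q <int F = ∃[ α ] 0ℚ ℚ.≤ α × Admissible F α × q ℚ.< α

  -- r ≤ int(F), as inclusion of lower cuts.
  _≤int_ : ℚ → SubsetOf setoid → Set
  r ≤int F = ∀ q → q ℚ.< r → q <int F

  record IsDecomposition (𝔅ₙ : ℕ → SubsetOf setoid) : Set where
    field
      union      : ∀ a → (¬ a ≈ ⊥) ⇔ (∃[ n ] a ∈ 𝔅ₙ n)
      increasing : ∀ n → 𝔅ₙ n ⊆ 𝔅ₙ (suc n)
      int≥2^-n   : ∀ n → (2^- n) ≤int 𝔅ₙ n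
      splitting  : ∀ n {a} → a ∈ 𝔅ₙ n →
        ∃[ b ] ∃[ c ] b ∈ 𝔅ₙ (suc n) × c ∈ 𝔅ₙ (suc n) ×
          Disjoint b c × b ∨ c ≤ a

{-# OPTIONS --safe #-}
-- If 𝔅 decomposes, an antichain meets 𝔅ₙ in at most 2ⁿ elements, since among
-- 2ⁿ + 1 elements of 𝔅ₙ two have a nonzero meet; so it is countable.
--
-- Conversely, let 𝔅 be ccc.  MA for ℵ₁ dense sets gives property (K): among
-- uncountably many nonzero elements, uncountably many meet pairwise.  Consider
-- the poset of finite forests of binary trees of a common height, labelled by
-- nonzero elements of 𝔅 that decrease along the branches and are disjoint at
-- siblings.  By (K), applied to the finitely many labels in turn, it is ccc.
-- For a filter G meeting fewer than 2^ℵ₀ suitable dense sets, the elements of 𝔅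
-- above some label at a fixed node are centred, and these centred families
-- cover 𝔅 ∖ {0}.  If 𝔅ₙ is the union of the families at the nodes of level n, of
-- which there are fewer than 2ⁿ, then int(𝔅ₙ) ≥ 2⁻ⁿ by the pigeonhole principle,
-- and the two children of a node provide the splitting.

module Submission where

open import Defs
open import Algebra.Lattice.Bundles using (BooleanAlgebra)
import Algebra.Lattice.Properties.BooleanAlgebra as BooleanAlgebraProperties
open import Axiom.ExcludedMiddle using (ExcludedMiddle)
open import Data.Bool.Base as Bool using (Bool; true; false)
import Data.Bool.Properties as Bool
open import Data.Empty using (⊥; ⊥-elim)
open import Data.Fin.Base as Fin using (Fin; zero; suc; toℕ)
import Data.Fin.Properties as Fin
open import Data.Fin.Subset using (Subset; ∣_∣) renaming (⊤ to ⊤ᴵ)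
open import Data.Fin.Subset.Properties using (∣⊤∣≡n)
import Data.Integer.Base as ℤ
import Data.Integer.Properties as ℤ
open import Data.List.Base using (List; []; _∷_; length; replicate)
open import Data.List.Membership.Propositional using () renaming (_∈_ to _∈ᴸ_)
open import Data.List.Properties using (length-replicate)
open import Data.List.Relation.Unary.Any using (here; there)
open import Data.Nat.Base as ℕ
  using (ℕ; zero; suc; _+_; _*_; _^_; _≤_; _<_; s≤s; _≤′_; ≤′-refl; ≤′-step)
open import Data.Nat.Induction using (<-rec)
import Data.Nat.Properties as ℕ
open import Data.Product.Base using (Σ; ∃; _×_; _,_; proj₁; proj₂; swap)
open import Data.Rational.Base as ℚ using (_/_; toℚᵘ)
import Data.Rational.Properties as ℚ
open import Data.Rational.Unnormalised.Base as ℚᵘ using (mkℚᵘ; *≤*; *<*; *≡*)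
import Data.Rational.Unnormalised.Properties as ℚᵘ
open import Data.Sum.Base using (_⊎_; inj₁; inj₂)
open import Data.Unit.Base using (⊤; tt)
import Data.Vec.Base as Vec
open import Function.Base using (_∘_; id)
open import Function.Bundles using (Func; Injection; Equivalence; _⇔_; mk⇔)
open import Induction.WellFounded using (Acc; acc)
open import Level using (0ℓ; Lift; lift) renaming (suc to lsuc)
open import Relation.Binary.Bundles using (Setoid; Poset; StrictTotalOrder)
import Relation.Binary.Construct.On as On
open import Relation.Binary.Definitions using (tri<; tri≈; tri>)
open import Relation.Binary.Lattice using (MeetSemilattice; Lattice)
open import Relation.Binary.PropositionalEquality
  using (_≡_; refl; sym; trans; cong; cong₂; subst; subst₂)
import Relation.Binary.Reasoning.Setoid as SetoidReasoning
open import Relation.Nullary using (¬_; Dec; yes; no; does)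
open import Relation.Nullary.Decidable using (decidable-stable)
open import Relation.Nullary.Negation using (contradiction)
open import Relation.Unary using (Pred; _≐_)

-- Countability

double-injective : ∀ m n → m + m ≡ n + n → m ≡ n
double-injective zero    zero    eq = refl
double-injective (suc m) (suc n) eq = cong suc (double-injective m n
  (ℕ.suc-injective (trans (sym (ℕ.+-suc m m)) (trans (ℕ.suc-injective eq) (ℕ.+-suc n n)))))

odd≢even : ∀ m n → ¬ suc (m + m) ≡ n + n
odd≢even zero    (suc n) eq = contradiction (trans (ℕ.suc-injective eq) (ℕ.+-suc n n)) λ ()
odd≢even (suc m) (suc n) eq = odd≢even m n
  (ℕ.suc-injective (trans (cong suc (sym (ℕ.+-suc m m))) (trans (ℕ.suc-injective eq) (ℕ.+-suc n n))))

-- This is `2 ^ i * (2 * j + 1)`, whence parity recovers `i` and then `j`.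
pair : ℕ → ℕ → ℕ
pair zero    j = suc (j + j)
pair (suc i) j = pair i j + pair i j

pair-injective : ∀ i i′ {j j′} → pair i j ≡ pair i′ j′ → i ≡ i′ × j ≡ j′
pair-injective zero    zero     eq = refl , double-injective _ _ (ℕ.suc-injective eq)
pair-injective zero    (suc i′) {j} eq = contradiction eq (odd≢even j (pair i′ _))
pair-injective (suc i) zero {j′ = j′} eq = contradiction (sym eq) (odd≢even j′ (pair i _))
pair-injective (suc i) (suc i′) eq with pair-injective i i′ (double-injective (pair i _) _ eq)
... | refl , eq′ = refl , eq′

-- Countability witnessed by a code that need not respect the equality of S.
Coded : Setoid 0ℓ 0ℓ → Set
Coded S = Σ (Carrier → ℕ) λ c → ∀ {x y} → c x ≡ c y → x ≈ y
  where open Setoid S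

countable⇒coded : ∀ {S} → Countable S → Coded S
countable⇒coded f = Injection.to f , Injection.injective f

coded-⊆ : ∀ S {P Q : Pred (Setoid.Carrier S) 0ℓ} →
          (∀ {x} → P x → Q x) → Coded (restrict S Q) → Coded (restrict S P)
coded-⊆ S P⊆Q (c , c-injective) = (λ (x , p) → c (x , P⊆Q p)) , c-injective

coded-∅ : ∀ S {P : Pred (Setoid.Carrier S) 0ℓ} → (∀ x → ¬ P x) → Coded (restrict S P)
coded-∅ S empty = (λ _ → 0) , λ {(x , p)} _ → contradiction p (empty x)

module Classical (em : ∀ {ℓ} → ExcludedMiddle ℓ) where

  by-contradiction : ∀ {a} {A : Set a} → ¬ ¬ A → A
  by-contradiction = decidable-stable em

  Least : Pred ℕ 0ℓ → Set
  Least P = ∃ λ n → P n × (∀ m → P m → n ≤ m)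

  least : ∀ {P} n → P n → Least P
  least {P} = <-rec (λ n → P n → Least P) step
    where
    step : ∀ n → (∀ {m} → m < n → P m → Least P) → P n → Least P
    step n rec pn with em {P = ∃ λ m → m < n × P m}
    ... | yes (m , m<n , pm) = rec m<n pm
    ... | no  minimal = n , pn , λ m pm → ℕ.≮⇒≥ λ m<n → minimal (m , m<n , pm)

  -- The least code occurring in the class of `x` depends only on that class and still determines
  -- it.
  coded⇒countable : ∀ {S} → Coded S → Countable S
  coded⇒countable {S} (c , c-injective) = record
    { to        = code
    ; cong      = λ x≈y → ℕ.≤-antisym (code-mono (S.sym x≈y)) (code-mono x≈y)
    ; injective = λ {x} {y} → code-injective x y
    }
    where
    module S = Setoid S
    leastCode : ∀ x → Least (λ n → ∃ λ y → y S.≈ x × c y ≡ n)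
    leastCode x = least (c x) (x , S.refl , refl)
    code : S.Carrier → ℕ
    code = proj₁ ∘ leastCode
    code-mono : ∀ {x y} → y S.≈ x → code x ≤ code y
    code-mono {x} {y} y≈x = let _ , (z , z≈y , eq) , _ = leastCode y
                            in proj₂ (proj₂ (leastCode x)) _ (z , S.trans z≈y y≈x , eq)
    code-injective : ∀ x y → code x ≡ code y → x S.≈ y
    code-injective x y eq =
      let _ , (z  , z≈x  , cz≡)  , _ = leastCode x
          _ , (z′ , z′≈y , cz′≡) , _ = leastCode y
      in S.trans (S.sym z≈x) (S.trans (c-injective (trans cz≡ (trans eq (sym cz′≡)))) z′≈y)

  module _ (S : Setoid 0ℓ 0ℓ) where
    open Setoid S using (Carrier; _≈_)

    coded-⋃ℕ : {P : ℕ → Pred Carrier 0ℓ} → (∀ n → Coded (restrict S (P n))) →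
               Coded (restrict S λ x → ∃ λ n → P n x)
    coded-⋃ℕ {P} coded = (λ (x , n , p) → pair n (code n (x , p))) ,
      λ {(_ , m , _)} {(_ , n , _)} eq → let eq₁ , eq₂ = pair-injective m n eq in go eq₁ eq₂
      where
      code : ∀ n → Σ Carrier (P n) → ℕ
      code n = proj₁ (coded n)
      go : ∀ {m n x y p q} → m ≡ n → code m (x , p) ≡ code n (y , q) → x ≈ y
      go {n = n} refl = proj₂ (coded n)

    -- Indices with the same code are equal, so the slice at a code `n` lies in a single `P j`; this
    -- reduces the union to one over ℕ.
    coded-⋃ : (I : Setoid 0ℓ 0ℓ) → Coded I → {P : Setoid.Carrier I → Pred Carrier 0ℓ} →
              (∀ {i j x} → Setoid._≈_ I i j → P i x → P j x) →
              (∀ i → Coded (restrict S (P i))) →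
              Coded (restrict S λ x → ∃ λ i → P i x)
    coded-⋃ I (κ , κ-injective) {P} resp coded =
      coded-⊆ S {Q = λ x → ∃ λ n → Slice n x} (λ (i , p) → κ i , i , refl , p) (coded-⋃ℕ slice)
      where
      Slice : ℕ → Pred Carrier 0ℓ
      Slice n x = ∃ λ i → κ i ≡ n × P i x
      slice : ∀ n → Coded (restrict S (Slice n))
      slice n with em {P = ∃ λ i → κ i ≡ n}
      ... | yes (j , κj≡n) = coded-⊆ S {Q = P j}
              (λ (i , κi≡n , p) → resp (κ-injective (trans κi≡n (sym κj≡n))) p) (coded j)
      ... | no  unused = coded-∅ S λ x (i , κi≡n , p) → unused (i , κi≡n)

    uncoded-inhabited : {P Q : Pred Carrier 0ℓ} → ¬ Coded (restrict S P) →
                        Coded (restrict S Q) → ∃ λ x → P x × ¬ Q x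
    uncoded-inhabited uncoded coded = by-contradiction λ none → uncoded
      (coded-⊆ S (λ {x} p → by-contradiction λ ¬q → none (x , p , ¬q)) coded)

    -- Otherwise every `x` could take over the code of an equal member of `P`. This is the successor
    -- step for a sequence of ω₁ distinct elements.
    next-distinct : ¬ Coded S → ∀ {P} → Coded (restrict S P) → ∃ λ x → ∀ {y} → P y → ¬ y ≈ x
    next-distinct uncoded {P} (c , c-injective) = by-contradiction λ none → uncoded (enumerate λ x →
      by-contradiction λ new → none (x , λ {y} p y≈x → new (y , p , y≈x)))
      where
      enumerate : (∀ x → ∃ λ y → P y × y ≈ x) → Coded S
      enumerate old = (λ x → let y , p , _ = old x in c (y , p)) , λ {x} {x′} eq →
        let _ , _ , y≈x   = old x
            _ , _ , y′≈x′ = old x′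
        in Setoid.trans S (Setoid.sym S y≈x) (Setoid.trans S (c-injective eq) y′≈x′)

  -- Sequences of length ω₁

  module Omega₁ (ac : ∀ {ℓ} → AxiomOfChoice ℓ)
                (W : StrictTotalOrder 0ℓ 0ℓ 0ℓ) (isOmega₁ : IsOmega₁ W) where

    open StrictTotalOrder W using (module Eq; compare; <-respʳ-≈)
      renaming (Carrier to ∣W∣; _<_ to _<ᵂ_; _≈_ to _≈ᵂ_)
    open IsOmega₁ isOmega₁

    module _ (X : Setoid 0ℓ 0ℓ) (_R_ : Setoid.Carrier X → Setoid.Carrier X → Set)
             (next : ∀ {P} → Coded (restrict X P) → ∃ λ x → ∀ {y} → P y → y R x)
             where
      open Setoid X using (Carrier; _≈_)

      private
        -- Subsets are compared by extension, so that a choice function on them must pick equal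
        -- elements for coextensive subsets.
        Subsets : Setoid (lsuc 0ℓ) (lsuc 0ℓ)
        Subsets = record
          { Carrier       = Pred Carrier 0ℓ
          ; _≈_           = λ P Q → Lift (lsuc 0ℓ) (P ≐ Q)
          ; isEquivalence = record
            { refl  = lift (id , id)
            ; sym   = λ (lift (f , g)) → lift (g , f)
            ; trans = λ (lift (f , g)) (lift (f′ , g′)) → lift ((λ p → f′ (f p)) , λ q → g (g′ q))
            }
          }

        -- Codedness is a premise here, so that every `P`, coded or not, has a candidate and
        -- `choice` ranges over all subsets.
        Next : Pred Carrier 0ℓ → Carrier → Set
        Next P x = Coded (restrict X P) → ∀ {y} → P y → y R x

        Candidates : Setoid (lsuc 0ℓ) (lsuc 0ℓ)
        Candidates = record
          { Carrier       = Σ (Pred Carrier 0ℓ) λ P → ∃ (Next P)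
          ; _≈_           = λ (P , x , _) (Q , y , _) → Setoid._≈_ Subsets P Q × x ≈ y
          ; isEquivalence = record
            { refl  = Setoid.refl Subsets , Setoid.refl X
            ; sym   = λ (e , e′) → Setoid.sym Subsets e , Setoid.sym X e′
            ; trans = λ (e , e′) (f , f′) → Setoid.trans Subsets e f , Setoid.trans X e′ f′
            }
          }

        candidate : ∀ P → ∃ (Next P)
        candidate P with em {P = Coded (restrict X P)}
        ... | yes coded   = proj₁ (next coded) , λ _ → proj₂ (next coded)
        -- An uncoded `P` imposes no condition; any element serves, here one obtained from the empty
        -- set.
        ... | no  uncoded = proj₁ (next {λ _ → ⊥} (coded-∅ X λ _ ())) , λ coded → contradiction coded uncoded

        choice : Σ (Func Subsets Candidates) λ g → ∀ P → Setoid._≈_ Subsets (proj₁ (Func.to g P)) P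
        choice = ac record
          { to         = proj₁
          ; cong       = proj₁
          ; surjective = λ P → (P , candidate P) , proj₁
          }

        pick : Pred Carrier 0ℓ → Carrier
        pick P = proj₁ (proj₂ (Func.to (proj₁ choice) P))

        pick-cong : ∀ {P Q} → P ≐ Q → pick P ≈ pick Q
        pick-cong P≐Q = proj₂ (Func.cong (proj₁ choice) (lift P≐Q))

        pick-next : ∀ {P} → Next P (pick P)
        pick-next {P} coded p with Func.to (proj₁ choice) P | proj₂ choice P
        ... | P′ , x , isNext | lift (P′⊆P , P⊆P′) = isNext (coded-⊆ X P′⊆P coded) (P⊆P′ p)

        -- Recursion is on accessibility proofs, so that their irrelevance
        -- (up to _≈_) and the congruence of the sequence are one induction.
        seq : ∀ w → Acc _<ᵂ_ w → Carrier
        seq w (acc rs) = pick λ x → ∃ λ v → Σ (v <ᵂ w) λ v<w → x ≈ seq v (rs v<w)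

        seq-cong : ∀ {v w} → v ≈ᵂ w → (a : Acc _<ᵂ_ v) (b : Acc _<ᵂ_ w) → seq v a ≈ seq w b
        seq-cong v≈w (acc rs) (acc rs′) = pick-cong
          ( (λ (u , u<v , x≈) → u , <-respʳ-≈ v≈w u<v ,
               Setoid.trans X x≈ (seq-cong Eq.refl (rs u<v) (rs′ _)))
          , (λ (u , u<w , x≈) → u , <-respʳ-≈ (Eq.sym v≈w) u<w ,
               Setoid.trans X x≈ (Setoid.sym X (seq-cong Eq.refl (rs _) (rs′ u<w)))) )

        -- Each `w` has countably many predecessors, and equal predecessors have equal values, so
        -- the values before `w` form a coded set, to which `pick-next` applies.
        seq-next : ∀ {v w} → v <ᵂ w → (a : Acc _<ᵂ_ v) (b : Acc _<ᵂ_ w) → seq v a R seq w b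
        seq-next {v} {w} v<w a (acc rs) = pick-next coded (v , v<w , seq-cong Eq.refl a (rs v<w))
          where
          κ = countable⇒coded (countableInitial w)
          coded : Coded (restrict X λ x → ∃ λ v → Σ (v <ᵂ w) λ v<w → x ≈ seq v (rs v<w))
          coded = (λ (_ , u , u<w , _) → proj₁ κ (u , u<w)) ,
            λ {(_ , _ , u<w , x≈)} {(_ , _ , u′<w , y≈)} eq →
              Setoid.trans X x≈ (Setoid.trans X (seq-cong (proj₂ κ eq) (rs u<w) (rs u′<w)) (Setoid.sym X y≈))

      ω₁-sequence : ∃ λ (e : ∣W∣ → Carrier) →
        (∀ {v w} → v ≈ᵂ w → e v ≈ e w) × (∀ {v w} → v <ᵂ w → e v R e w)
      ω₁-sequence = (λ w → seq w (wellFounded w)) ,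
        (λ v≈w → seq-cong v≈w (wellFounded _) (wellFounded _)) ,
        (λ v<w → seq-next v<w (wellFounded _) (wellFounded _))

    coded-≤ : ∀ w → Coded (restrict Eq.setoid λ v → v <ᵂ w ⊎ v ≈ᵂ w)
    coded-≤ w = code , λ {x} {y} → injective x y
      where
      κ = countable⇒coded (countableInitial w)
      code : ∃ (λ v → v <ᵂ w ⊎ v ≈ᵂ w) → ℕ
      code (v , inj₁ v<w) = suc (proj₁ κ (v , v<w))
      code (v , inj₂ _)   = 0
      injective : ∀ x y → code x ≡ code y → proj₁ x ≈ᵂ proj₁ y
      injective (_ , inj₁ _)   (_ , inj₁ _)   eq = proj₂ κ (ℕ.suc-injective eq)
      injective (_ , inj₂ v≈w) (_ , inj₂ u≈w) eq = Eq.trans v≈w (Eq.sym u≈w)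

    -- A countable unbounded set would make ω₁ a countable union of countable initial segments.
    unbounded⇒uncoded : ∀ {P} → (∀ w → ∃ λ v → w <ᵂ v × P v) → ¬ Coded (restrict Eq.setoid P)
    unbounded⇒uncoded {P} unbounded coded = uncountable (coded⇒countable
      ((λ w → proj₁ below (w , cover w)) , proj₂ below))
      where
      below : Coded (restrict Eq.setoid λ v → ∃ λ ((w , _) : ∃ P) → v <ᵂ w ⊎ v ≈ᵂ w)
      below = coded-⋃ Eq.setoid (restrict Eq.setoid P) coded
        (λ { w≈w′ (inj₁ v<w) → inj₁ (<-respʳ-≈ w≈w′ v<w)
           ; w≈w′ (inj₂ v≈w) → inj₂ (Eq.trans v≈w w≈w′) })
        (λ (w , _) → coded-≤ w)
      cover : ∀ w → ∃ λ ((v , _) : ∃ P) → w <ᵂ v ⊎ w ≈ᵂ v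
      cover w = let v , w<v , p = unbounded w in (v , p) , inj₁ w<v

    -- The initial segment up to `w` is countable, so it cannot contain all of `P`.
    uncoded⇒unbounded : ∀ {P} → ¬ Coded (restrict Eq.setoid P) → ∀ w → ∃ λ v → w <ᵂ v × P v
    uncoded⇒unbounded uncoded w with uncoded-inhabited Eq.setoid uncoded (coded-≤ w)
    ... | v , p , v≰w with compare v w
    ... | tri< v<w _ _ = contradiction (inj₁ v<w) v≰w
    ... | tri≈ _ v≈w _ = contradiction (inj₂ v≈w) v≰w
    ... | tri> _ _ w<v = v , w<v , p

    uncountable-fibre : (h : ∣W∣ → ℕ) → ∃ λ n → ¬ Coded (restrict Eq.setoid λ w → h w ≡ n)
    uncountable-fibre h = by-contradiction λ none →
      let c , c-injective = coded-⋃ℕ Eq.setoid {P = λ n w → h w ≡ n}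
            (λ n → by-contradiction λ uncoded → none (n , uncoded))
      in uncountable (coded⇒countable ((λ w → c (w , h w , refl)) ,
           λ {v} {w} → c-injective {v , h v , refl} {w , h w , refl}))

    ω₁-element : ∣W∣
    ω₁-element = proj₁ (by-contradiction {A = ∃ λ (w : ∣W∣) → ⊤} λ empty →
      uncountable (coded⇒countable ((λ _ → 0) , λ {w} _ → contradiction (w , tt) empty)))

-- Order and disjointness in a Boolean algebra

module Order (𝔅 : BooleanAlgebra 0ℓ 0ℓ) where
  open BooleanAlgebra 𝔅 public
    using (Carrier; _≈_; _∧_; _∨_; setoid; ∧-cong; ∧-congˡ; ∧-comm; ∧-complementʳ)
    renaming (⊤ to 𝟙; ⊥ to 𝟘; ¬_ to ∁; refl to ≈-refl; reflexive to ≈-reflexive; sym to ≈-sym; trans to ≈-trans)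
  open BooleanAlgebra 𝔅 using (∨-complementʳ; ∧-distribˡ-∨; ∨-congˡ)
  open BooleanAlgebraProperties 𝔅 public using (poset)
  open BooleanAlgebraProperties 𝔅 using (∧-zeroʳ; ∧-identityʳ; ∨-identityʳ)
  private
    module P = Poset poset
    module M = MeetSemilattice (BooleanAlgebraProperties.∧-orderTheoreticMeetSemilattice 𝔅)
    module L = Lattice (BooleanAlgebraProperties.∨-∧-orderTheoreticLattice 𝔅)

  infix 4 _⊑_
  _⊑_ : Carrier → Carrier → Set
  x ⊑ y = x ≈ x ∧ y

  open P public using ()
    renaming (refl to ⊑-refl; reflexive to ⊑-reflexive; trans to ⊑-trans; antisym to ⊑-antisym)
  open M public using (x∧y≤x; x∧y≤y; ∧-greatest)
  open L public using (∨-least)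

  ∧-mono : ∀ {x y u v} → x ⊑ u → y ⊑ v → x ∧ y ⊑ u ∧ v
  ∧-mono x≤u y≤v = ∧-greatest (⊑-trans (x∧y≤x _ _) x≤u) (⊑-trans (x∧y≤y _ _) y≤v)

  ⊑-𝟙 : ∀ {x} → x ⊑ 𝟙
  ⊑-𝟙 = ≈-sym (∧-identityʳ _)

  a∧∁b≈𝟘⇒a⊑b : ∀ {a b} → a ∧ ∁ b ≈ 𝟘 → a ⊑ b
  a∧∁b≈𝟘⇒a⊑b {a} {b} a∧∁b≈𝟘 = begin
    a                  ≈⟨ ∧-identityʳ a ⟨
    a ∧ 𝟙              ≈⟨ ∧-congˡ (∨-complementʳ b) ⟨
    a ∧ (b ∨ ∁ b)      ≈⟨ ∧-distribˡ-∨ a b (∁ b) ⟩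
    a ∧ b ∨ a ∧ ∁ b    ≈⟨ ∨-congˡ a∧∁b≈𝟘 ⟩
    a ∧ b ∨ 𝟘          ≈⟨ ∨-identityʳ (a ∧ b) ⟩
    a ∧ b              ∎
    where open SetoidReasoning setoid

  ⊑𝟘⇒≈𝟘 : ∀ {x} → x ⊑ 𝟘 → x ≈ 𝟘
  ⊑𝟘⇒≈𝟘 x≤𝟘 = ≈-trans x≤𝟘 (∧-zeroʳ _)

  ≉𝟘-upward : ∀ {x y} → x ⊑ y → ¬ x ≈ 𝟘 → ¬ y ≈ 𝟘
  ≉𝟘-upward x≤y x≉𝟘 y≈𝟘 = x≉𝟘 (⊑𝟘⇒≈𝟘 (⊑-trans x≤y (⊑-reflexive y≈𝟘)))

  disjoint-⊑ : ∀ {x y u v} → x ⊑ u → y ⊑ v → u ∧ v ≈ 𝟘 → x ∧ y ≈ 𝟘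
  disjoint-⊑ x≤u y≤v u∧v≈𝟘 = ⊑𝟘⇒≈𝟘 (⊑-trans (∧-mono x≤u y≤v) (⊑-reflexive u∧v≈𝟘))

  disjoint⇒≉ : ∀ {x y} → ¬ x ≈ 𝟘 → x ∧ y ≈ 𝟘 → ¬ x ≈ y
  disjoint⇒≉ x≉𝟘 x∧y≈𝟘 x≈y = x≉𝟘 (⊑𝟘⇒≈𝟘 (⊑-trans (∧-greatest ⊑-refl (⊑-reflexive x≈y)) (⊑-reflexive x∧y≈𝟘)))

-- Property (K) from Martin's Axiom

module CCCUnderMA (em : ∀ {ℓ} → ExcludedMiddle ℓ) (ac : ∀ {ℓ} → AxiomOfChoice ℓ)
                  (ma : MartinsAxiom)
                  (W : StrictTotalOrder 0ℓ 0ℓ 0ℓ) (isOmega₁ : IsOmega₁ W)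
                  (W≺𝔠 : StrictTotalOrder.Eq.setoid W ≺ Continuum)
                  (𝔅 : BooleanAlgebra 0ℓ 0ℓ) (ccc : CCC 𝔅) where

  open Classical em
  open Omega₁ ac W isOmega₁
  open Order 𝔅
  open StrictTotalOrder W using (module Eq; compare; <-respˡ-≈)
    renaming (Carrier to ∣W∣; _<_ to _<ᵂ_; _≈_ to _≈ᵂ_)

  module _ (I : Setoid 0ℓ 0ℓ) (h : Setoid.Carrier I → Carrier)
           (h-cong : ∀ {i j} → Setoid._≈_ I i j → h i ≈ h j) (h≉𝟘 : ∀ i → ¬ h i ≈ 𝟘)
           (h-disjoint : ∀ {i j} → ¬ Setoid._≈_ I i j → h i ∧ h j ≈ 𝟘) where

    private
      Range : SubsetOf setoid
      Range = record
        { member = λ a → ∃ λ i → a ≈ h i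
        ; resp   = λ a≈b (i , a≈) → i , ≈-trans (≈-sym a≈b) a≈
        }

      range-coded : Coded (subsetoid Range)
      range-coded = countable⇒coded (ccc Range
        (λ (i , a≈) a≈𝟘 → h≉𝟘 i (≈-trans (≈-sym a≈) a≈𝟘))
        (λ (i , a≈) (j , b≈) a≉b → ≈-trans (∧-cong a≈ b≈)
          (h-disjoint λ i≈j → a≉b (≈-trans a≈ (≈-trans (h-cong i≈j) (≈-sym b≈))))))

    -- Unequal indices have disjoint nonzero values, hence unequal ones, so a code for the range
    -- also codes the indices.
    disjoint-family-coded : Coded I
    disjoint-family-coded = (λ i → proj₁ range-coded (h i , i , ≈-refl)) , λ {i} {j} eq →
      by-contradiction λ i≉j → disjoint⇒≉ (h≉𝟘 i) (h-disjoint i≉j) (proj₂ range-coded eq)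

  module _ (f : ∣W∣ → Carrier) {S : Pred ∣W∣ 0ℓ} (f≉𝟘 : ∀ {w} → S w → ¬ f w ≈ 𝟘)
           (S-uncoded : ¬ Coded (restrict Eq.setoid S)) where

    private
      Meeting : Carrier → Pred ∣W∣ 0ℓ
      Meeting b w = S w × ¬ f w ∧ b ≈ 𝟘

      Light : Pred Carrier 0ℓ
      Light b = ¬ b ≈ 𝟘 × Coded (restrict Eq.setoid (Meeting b))

    -- If countably many f w meet each of densely many elements, such elements
    -- can be chosen disjoint from all previous ones, ω₁ times.
    heavy-element : ∃ λ a → ¬ a ≈ 𝟘 ×
      (∀ {b} → ¬ b ≈ 𝟘 → b ⊑ a → ¬ Coded (restrict Eq.setoid (Meeting b)))
    heavy-element = by-contradiction λ none →
      let lightBelow : ∀ {a} → ¬ a ≈ 𝟘 → ∃ λ b → b ⊑ a × Light b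
          lightBelow {a} a≉𝟘 = by-contradiction λ no-light → none
            (a , a≉𝟘 , λ {b} b≉𝟘 b≤a coded → no-light (b , b≤a , b≉𝟘 , coded))
          e , e-cong , e-disjoint = ω₁-sequence (restrict setoid Light)
            (λ x y → proj₁ x ∧ proj₁ y ≈ 𝟘) (next lightBelow)
      in IsOmega₁.uncountable isOmega₁ (coded⇒countable (disjoint-family-coded Eq.setoid
           (λ w → proj₁ (e w)) e-cong (λ w → proj₁ (proj₂ (e w))) (disjoint {e} e-disjoint)))
      where
      disjoint : {e : ∣W∣ → ∃ Light} → (∀ {v w} → v <ᵂ w → proj₁ (e v) ∧ proj₁ (e w) ≈ 𝟘) →
                 ∀ {v w} → ¬ v ≈ᵂ w → proj₁ (e v) ∧ proj₁ (e w) ≈ 𝟘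
      disjoint e-disjoint {v} {w} v≉w with compare v w
      ... | tri< v<w _ _ = e-disjoint v<w
      ... | tri≈ _ v≈w _ = contradiction v≈w v≉w
      ... | tri> _ _ w<v = ≈-trans (∧-comm _ _) (e-disjoint w<v)
      next : (∀ {a} → ¬ a ≈ 𝟘 → ∃ λ b → b ⊑ a × Light b) →
             ∀ {P} → Coded (restrict (restrict setoid Light) P) →
             ∃ λ (x : ∃ Light) → ∀ {y} → P y → proj₁ y ∧ proj₁ x ≈ 𝟘
      next lightBelow {P} P-coded =
        -- Countably many light elements are together met by `f w` for only countably many `w` in
        -- `S`, so some `f w` is disjoint from all of them; the new light element is taken below it.
        let w , Sw , unmet = uncoded-inhabited Eq.setoid S-uncoded
              (coded-⋃ Eq.setoid (restrict (restrict setoid Light) P) P-coded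
                {P = λ ((b , _) , _) → Meeting b}
                (λ b≈b′ (Sw , meets) → Sw , λ eq → meets (≈-trans (∧-congˡ b≈b′) eq))
                (λ ((_ , _ , coded) , _) → coded))
            b , b≤fw , light = lightBelow (f≉𝟘 Sw)
        in (b , light) , λ {y} p → disjoint-⊑ ⊑-refl b≤fw
             (≈-trans (∧-comm _ _) (by-contradiction λ meets → unmet ((y , p) , Sw , meets)))

    abstract
      -- Below a heavy `a` every nonzero element meets `f v` for unboundedly many `v` in `S`, so
      -- each `D w` is dense in the ccc poset of nonzero elements below `a`. A filter through all of
      -- them has elements below `f v` for unboundedly many `v`, and any two such `f v` meet by
      -- directedness.
      k-property : ∃ λ (S′ : Pred ∣W∣ 0ℓ) → (∀ {w} → S′ w → S w) ×
        ¬ Coded (restrict Eq.setoid S′) × (∀ {v w} → S′ v → S′ w → ¬ f v ∧ f w ≈ 𝟘)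
      k-property =
        (λ w → S w × ∃ λ p → p ∈ G × proj₁ p ⊑ f w) , proj₁ ,
        unbounded⇒uncoded (λ w → let p , p∈G , v , w<v , Sv , p≤fv = meets w
                                 in v , w<v , Sv , p , p∈G , p≤fv) ,
        λ (_ , p , p∈G , p≤fv) (_ , q , q∈G , q≤fw) →
          let (r , r≉𝟘 , _) , _ , r≤p , r≤q = directed p∈G q∈G
          in ≉𝟘-upward (∧-greatest (⊑-trans r≤p p≤fv) (⊑-trans r≤q q≤fw)) r≉𝟘
        where
        a : Carrier
        a = proj₁ heavy-element
        P : Poset 0ℓ 0ℓ 0ℓ
        P = On.poset {B = ∃ λ b → ¬ b ≈ 𝟘 × b ⊑ a} poset proj₁
        module P = Poset P

        P-ccc : NoUncountableAntichain P
        P-ccc (A , incompatible , uncountable) = uncountable (coded⇒countable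
          (disjoint-family-coded (subsetoid A) (λ (p , _) → proj₁ p) id (λ (p , _) → proj₁ (proj₂ p))
            -- A nonzero meet would be a common lower bound in `P`, so incompatible elements are
            -- disjoint.
            λ {(p , p∈A)} {(q , q∈A)} p≉q → by-contradiction λ meet → incompatible p∈A q∈A p≉q
              ( (proj₁ p ∧ proj₁ q , meet , ⊑-trans (x∧y≤x _ _) (proj₂ (proj₂ p)))
              , x∧y≤x _ _ , x∧y≤y _ _ )))

        D : ∣W∣ → SubsetOf P.Eq.setoid
        D w = record
          { member = λ (b , _) → ∃ λ v → w <ᵂ v × S v × b ⊑ f v
          ; resp   = λ b≈c (v , w<v , Sv , b≤fv) → v , w<v , Sv , ⊑-trans (⊑-reflexive (≈-sym b≈c)) b≤fv
          }

        D-dense : ∀ w → Dense P (D w)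
        D-dense w (b , b≉𝟘 , b≤a) =
          let v , w<v , Sv , meet = uncoded⇒unbounded (proj₂ (proj₂ heavy-element) b≉𝟘 b≤a) w
          in (f v ∧ b , meet , ⊑-trans (x∧y≤y _ _) b≤a) , (v , w<v , Sv , x∧y≤x _ _) , x∧y≤y _ _

        generic : ∃ λ G → IsFilter P G × (∀ w → ∃ λ p → p ∈ G × p ∈ D w)
        generic = ma P (a , proj₁ (proj₂ heavy-element) , ⊑-refl) P-ccc Eq.setoid W≺𝔠 D
          (λ v≈w {x} (u , v<u , rest) → u , <-respˡ-≈ v≈w v<u , rest) D-dense
        G : SubsetOf P.Eq.setoid
        G = proj₁ generic
        open IsFilter {P = P} {G = G} (proj₁ (proj₂ generic))
        meets : ∀ w → ∃ λ p → p ∈ G × p ∈ D w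
        meets = proj₂ (proj₂ generic)

-- Finite sets of indices

member : ∀ {m} (I : Subset m) → 0 < ∣ I ∣ → ∃ λ i → Vec.lookup I i ≡ true
member (true  Vec.∷ I) _   = zero , refl
member (false Vec.∷ I) 0<∣I∣ = let i , i∈I = member I 0<∣I∣ in suc i , i∈I

two-members : ∀ {m} (I : Subset m) → 1 < ∣ I ∣ →
  ∃ λ i → ∃ λ j → ¬ i ≡ j × Vec.lookup I i ≡ true × Vec.lookup I j ≡ true
two-members (true  Vec.∷ I) (s≤s 0<∣I∣) =
  let j , j∈I = member I 0<∣I∣ in zero , suc j , (λ ()) , refl , j∈I
two-members (false Vec.∷ I) 1<∣I∣ =
  let i , j , i≢j , i∈I , j∈I = two-members I 1<∣I∣
  in suc i , suc j , (λ eq → i≢j (Fin.suc-injective eq)) , i∈I , j∈I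

filterᴵ : ∀ {m} → Bool → Subset m → (Fin m → Bool) → Subset m
filterᴵ b Vec.[]      g = Vec.[]
filterᴵ b (x Vec.∷ I) g = (x Bool.∧ does (g zero Bool.≟ b)) Vec.∷ filterᴵ b I (g ∘ suc)

lookup-filterᴵ : ∀ {m} b (I : Subset m) g i → Vec.lookup (filterᴵ b I g) i ≡ true →
                 Vec.lookup I i ≡ true × g i ≡ b
lookup-filterᴵ b (true Vec.∷ I) g zero eq with g zero Bool.≟ b
... | yes g0≡b = refl , g0≡b
lookup-filterᴵ b (x Vec.∷ I) g (suc i) eq = lookup-filterᴵ b I (g ∘ suc) i eq

∣filterᴵ∣ : ∀ {m} (I : Subset m) g → ∣ I ∣ ≡ ∣ filterᴵ true I g ∣ + ∣ filterᴵ false I g ∣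
∣filterᴵ∣ Vec.[]          g = refl
∣filterᴵ∣ (false Vec.∷ I) g = ∣filterᴵ∣ I (g ∘ suc)
∣filterᴵ∣ (true  Vec.∷ I) g with g zero
... | true  = cong suc (∣filterᴵ∣ I (g ∘ suc))
... | false = trans (cong suc (∣filterᴵ∣ I (g ∘ suc))) (sym (ℕ.+-suc _ _))

majority : ∀ {m} (I : Subset m) (g : Fin m → Bool) → ∃ λ b → ∣ I ∣ ≤ 2 * ∣ filterᴵ b I g ∣
majority I g with ℕ.≤-total ∣ filterᴵ true I g ∣ ∣ filterᴵ false I g ∣
... | inj₁ t≤f = false , ℕ.≤-trans (ℕ.≤-reflexive (∣filterᴵ∣ I g))
                   (ℕ.+-mono-≤ t≤f (ℕ.≤-reflexive (sym (ℕ.+-identityʳ _))))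
... | inj₂ f≤t = true , ℕ.≤-trans (ℕ.≤-reflexive (∣filterᴵ∣ I g))
                   (ℕ.+-monoʳ-≤ _ (ℕ.≤-trans f≤t (ℕ.≤-reflexive (sym (ℕ.+-identityʳ _)))))

-- By induction on `n`: the more frequent first letter keeps at least half of the indices, and the
-- induction hypothesis treats the tails.
pigeonhole-words : ∀ {m} n (I : Subset m) (g : Fin m → List Bool) → (∀ i → length (g i) ≡ n) →
  ∃ λ w → ∃ λ (J : Subset m) → ∣ I ∣ ≤ ∣ J ∣ * 2 ^ n ×
    (∀ i → Vec.lookup J i ≡ true → Vec.lookup I i ≡ true × g i ≡ w)
pigeonhole-words zero I g ∣g∣≡0 =
  [] , I , ℕ.≤-reflexive (sym (ℕ.*-identityʳ _)) , λ i i∈I → i∈I , length-zero (∣g∣≡0 i)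
  where
  length-zero : ∀ {w : List Bool} → length w ≡ 0 → w ≡ []
  length-zero {[]} _ = refl
pigeonhole-words (suc n) I g ∣g∣≡1+n =
  let b , ∣I∣≤2∣I′∣ = majority I head
      I′ = filterᴵ b I head
      w , J , ∣I′∣≤ , J-spec = pigeonhole-words n I′ (λ i → proj₁ (proj₂ (uncons i)))
                                 (λ i → proj₂ (proj₂ (proj₂ (uncons i))))
  in b ∷ w , J ,
     (begin
       ∣ I ∣                ≤⟨ ∣I∣≤2∣I′∣ ⟩
       2 * ∣ I′ ∣           ≤⟨ ℕ.*-monoʳ-≤ 2 ∣I′∣≤ ⟩
       2 * (∣ J ∣ * 2 ^ n)  ≡⟨ sym (ℕ.*-assoc 2 ∣ J ∣ (2 ^ n)) ⟩
       2 * ∣ J ∣ * 2 ^ n    ≡⟨ cong (_* 2 ^ n) (ℕ.*-comm 2 ∣ J ∣) ⟩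
       ∣ J ∣ * 2 * 2 ^ n    ≡⟨ ℕ.*-assoc ∣ J ∣ 2 (2 ^ n) ⟩
       ∣ J ∣ * 2 ^ suc n    ∎) ,
     λ i i∈J → let i∈I′ , tail≡w = J-spec i i∈J
                   i∈I , head≡b = lookup-filterᴵ b I head i i∈I′
               in i∈I , trans (proj₁ (proj₂ (proj₂ (uncons i)))) (cong₂ _∷_ head≡b tail≡w)
  where
  open ℕ.≤-Reasoning
  uncons : ∀ i → ∃ λ b → ∃ λ w → g i ≡ b ∷ w × length w ≡ n
  uncons i with g i | ∣g∣≡1+n i
  ... | b ∷ w | eq = b , w , refl , ℕ.suc-injective eq
  head : Fin _ → Bool
  head i = proj₁ (uncons i)

-- Unit fractions

toℚᵘ-/ : ∀ k d .{{_ : ℕ.NonZero d}} → toℚᵘ (ℤ.+ k / d) ℚᵘ.≃ (ℤ.+ k ℚᵘ./ d)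
toℚᵘ-/ k (suc d) = ℚ.toℚᵘ-fromℚᵘ (mkℚᵘ (ℤ.+ k) d)

m≤k*d⇒m/d≤k : ∀ m k d .{{_ : ℕ.NonZero d}} → m ≤ k * d →
              (ℤ.+ 1 / d) ℚ.* (ℤ.+ m / 1) ℚ.≤ ℤ.+ k / 1
m≤k*d⇒m/d≤k m k d@(suc _) m≤k*d = ℚ.toℚᵘ-cancel-≤ (begin
  toℚᵘ ((ℤ.+ 1 / d) ℚ.* (ℤ.+ m / 1))      ≃⟨ ℚ.toℚᵘ-homo-* (ℤ.+ 1 / d) (ℤ.+ m / 1) ⟩
  toℚᵘ (ℤ.+ 1 / d) ℚᵘ.* toℚᵘ (ℤ.+ m / 1)  ≃⟨ ℚᵘ.*-cong (toℚᵘ-/ 1 d) (toℚᵘ-/ m 1) ⟩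
  (ℤ.+ 1 ℚᵘ./ d) ℚᵘ.* (ℤ.+ m ℚᵘ./ 1)      ≤⟨ *≤* cross ⟩
  ℤ.+ k ℚᵘ./ 1                            ≃⟨ toℚᵘ-/ k 1 ⟨
  toℚᵘ (ℤ.+ k / 1)                        ∎)
  where
  open ℚᵘ.≤-Reasoning
  cross : (ℤ.+ 1 ℤ.* ℤ.+ m) ℤ.* ℤ.+ 1 ℤ.≤ ℤ.+ k ℤ.* ℤ.+ (d * 1)
  cross = subst₂ ℤ._≤_ (sym (trans (ℤ.*-identityʳ _) (ℤ.*-identityˡ _)))
    (trans (cong (λ d → ℤ.+ (k * d)) (sym (ℕ.*-identityʳ d))) (ℤ.pos-* k (d * 1))) (ℤ.+≤+ m≤k*d)

0≤2^-_ : ∀ n → ℚ.0ℚ ℚ.≤ 2^- n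
0≤2^- n = ℚ.nonNegative⁻¹ (2^- n) {{ℚ.normalize-nonNeg 1 (2 ^ n) {{ℕ.m^n≢0 2 n}}}}

1/[1+d]<1/d : ∀ d .{{_ : ℕ.NonZero d}} → ℤ.+ 1 / suc d ℚ.< ℤ.+ 1 / d
1/[1+d]<1/d d@(suc _) = ℚ.toℚᵘ-cancel-< (begin-strict
  toℚᵘ (ℤ.+ 1 / suc d)  ≃⟨ toℚᵘ-/ 1 (suc d) ⟩
  ℤ.+ 1 ℚᵘ./ suc d      <⟨ *<* (ℤ.+<+ ℕ.≤-refl) ⟩
  ℤ.+ 1 ℚᵘ./ d          ≃⟨ toℚᵘ-/ 1 d ⟨
  toℚᵘ (ℤ.+ 1 / d)      ∎)
  where open ℚᵘ.≤-Reasoning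

-- Multiplication by `1 + d` gives `1 < α * (1 + d) ≤ k`: in a sequence of `1 + d` elements, such an
-- `α` forces two indices.
1/d<α∧αd≤k⇒1<k : ∀ d k {α} → ℤ.+ 1 / suc d ℚ.< α → α ℚ.* (ℤ.+ suc d / 1) ℚ.≤ ℤ.+ k / 1 → 1 < k
1/d<α∧αd≤k⇒1<k d k {α} 1/d<α αd≤k = ℤ.drop‿+<+ (subst₂ ℤ._<_ (ℤ.*-identityʳ _) (ℤ.*-identityʳ _)
    (ℚᵘ.drop-*<* (ℚᵘ.<-respˡ-≃ (toℚᵘ-/ 1 1) (ℚᵘ.<-respʳ-≃ (toℚᵘ-/ k 1) (ℚ.toℚᵘ-mono-< 1<k)))))
  where
  d⁻¹*d≡1 : (ℤ.+ 1 / suc d) ℚ.* (ℤ.+ suc d / 1) ≡ ℤ.+ 1 / 1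
  d⁻¹*d≡1 = ℚ.toℚᵘ-injective (begin
    toℚᵘ ((ℤ.+ 1 / suc d) ℚ.* (ℤ.+ suc d / 1))      ≈⟨ ℚ.toℚᵘ-homo-* (ℤ.+ 1 / suc d) (ℤ.+ suc d / 1) ⟩
    toℚᵘ (ℤ.+ 1 / suc d) ℚᵘ.* toℚᵘ (ℤ.+ suc d / 1)  ≈⟨ ℚᵘ.*-cong (toℚᵘ-/ 1 (suc d)) (toℚᵘ-/ (suc d) 1) ⟩
    (ℤ.+ 1 ℚᵘ./ suc d) ℚᵘ.* (ℤ.+ suc d ℚᵘ./ 1)      ≈⟨ *≡* (trans (ℤ.*-identityʳ _)
                                                        (cong (λ d → ℤ.+ 1 ℤ.* ℤ.+ d) (sym (ℕ.*-identityʳ (suc d))))) ⟩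
    ℤ.+ 1 ℚᵘ./ 1                                    ≈⟨ toℚᵘ-/ 1 1 ⟨
    toℚᵘ (ℤ.+ 1 / 1)                                ∎)
    where open SetoidReasoning ℚᵘ.≃-setoid
  1<k : ℤ.+ 1 / 1 ℚ.< ℤ.+ k / 1
  1<k = begin-strict
    ℤ.+ 1 / 1                            ≡⟨ d⁻¹*d≡1 ⟨
    (ℤ.+ 1 / suc d) ℚ.* (ℤ.+ suc d / 1)  <⟨ ℚ.*-monoˡ-<-pos (ℤ.+ suc d / 1) {{ℚ.normalize-pos (suc d) 1}} 1/d<α ⟩
    α ℚ.* (ℤ.+ suc d / 1)                ≤⟨ αd≤k ⟩
    ℤ.+ k / 1                            ∎
    where open ℚ.≤-Reasoning

-- Finite meets over index sets

module Meets (𝔅 : BooleanAlgebra 0ℓ 0ℓ) where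
  open Order 𝔅

  ⋀-⊑ : ∀ {m} (I : Subset m) a i → Vec.lookup I i ≡ true → ⋀ 𝔅 I a ⊑ a i
  ⋀-⊑ (true Vec.∷ I) a zero    _   = x∧y≤x _ _
  ⋀-⊑ (b    Vec.∷ I) a (suc i) i∈I = ⊑-trans (x∧y≤y _ _) (⋀-⊑ I (a ∘ suc) i i∈I)

  ⋀-greatest : ∀ {m} (I : Subset m) a {r} → (∀ i → Vec.lookup I i ≡ true → r ⊑ a i) → r ⊑ ⋀ 𝔅 I a
  ⋀-greatest Vec.[]          a r≤ = ⊑-𝟙
  ⋀-greatest (true  Vec.∷ I) a r≤ = ∧-greatest (r≤ zero refl) (⋀-greatest I (a ∘ suc) (r≤ ∘ suc))
  ⋀-greatest (false Vec.∷ I) a r≤ = ∧-greatest ⊑-𝟙 (⋀-greatest I (a ∘ suc) (r≤ ∘ suc))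

-- From a decomposition to the countable chain condition

module Converse (em : ∀ {ℓ} → ExcludedMiddle ℓ) (𝔅 : BooleanAlgebra 0ℓ 0ℓ) where
  open Classical em
  open Order 𝔅
  open Meets 𝔅

  module _ (S : Setoid 0ℓ 0ℓ) (P : Pred (Setoid.Carrier S) 0ℓ) where
    open Setoid S using () renaming (Carrier to ∣S∣; _≈_ to _≈ˢ_)

    Distinct : ℕ → Set
    Distinct k = ∃ λ (v : Fin k → ∣S∣) → (∀ i → P (v i)) × (∀ i j → ¬ i ≡ j → ¬ v i ≈ˢ v j)

    -- If a list of distinct members cannot be prolonged, every member equals one of them, and its
    -- position is a code.
    distinct-or-coded : ∀ k → Distinct k ⊎ Coded (restrict S P)
    distinct-or-coded zero    = inj₁ ((λ ()) , (λ ()) , λ ())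
    distinct-or-coded (suc k) with distinct-or-coded k
    ... | inj₂ coded = inj₂ coded
    ... | inj₁ (v , Pv , v-distinct) with em {P = ∃ λ x → P x × (∀ i → ¬ x ≈ˢ v i)}
    ...   | yes (x , Px , x≉v) = inj₁ (v⁺ , Pv⁺ , v⁺-distinct)
      where
      v⁺ : Fin (suc k) → ∣S∣
      v⁺ zero    = x
      v⁺ (suc i) = v i
      Pv⁺ : ∀ i → P (v⁺ i)
      Pv⁺ zero    = Px
      Pv⁺ (suc i) = Pv i
      v⁺-distinct : ∀ i j → ¬ i ≡ j → ¬ v⁺ i ≈ˢ v⁺ j
      v⁺-distinct zero    zero    i≢j _  = i≢j refl
      v⁺-distinct zero    (suc j) _   eq = x≉v j eq
      v⁺-distinct (suc i) zero    _   eq = x≉v i (Setoid.sym S eq)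
      v⁺-distinct (suc i) (suc j) i≢j eq = v-distinct i j (i≢j ∘ cong suc) eq
    ...   | no exhausted = inj₂ ((λ (x , p) → toℕ (proj₁ (index x p))) ,
              λ {(x , p)} {(y , q)} eq → Setoid.trans S (proj₂ (index x p))
                (subst (λ i → v i ≈ˢ y) (sym (Fin.toℕ-injective eq)) (Setoid.sym S (proj₂ (index y q)))))
      where
      index : ∀ x → P x → ∃ λ i → x ≈ˢ v i
      index x p = by-contradiction λ none → exhausted (x , p , λ i x≈ → none (i , x≈))

  decomposition⇒ccc : ∃ (IsDecomposition 𝔅) → CCC 𝔅
  decomposition⇒ccc (𝔅ₙ , dec) A A≉𝟘 A-disjoint = coded⇒countable
    (coded-⊆ setoid {Q = λ a → ∃ λ n → a ∈ A × a ∈ 𝔅ₙ n}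
      (λ {a} a∈A → let n , a∈𝔅ₙ = Equivalence.to (union a) (A≉𝟘 a∈A) in n , a∈A , a∈𝔅ₙ)
      (coded-⋃ℕ setoid piece))
    where
    open IsDecomposition dec
    piece : ∀ n → Coded (restrict setoid λ a → a ∈ A × a ∈ 𝔅ₙ n)
    piece n with distinct-or-coded setoid (λ a → a ∈ A × a ∈ 𝔅ₙ n) (suc (2 ^ n))
    ... | inj₂ coded = coded
    ... | inj₁ (v , v∈ , v-distinct) =
      -- The bound `2^- n` holds as an inclusion of cuts, so it is applied to a rational strictly
      -- below; `1 / (2 ^ n + 1)` is still large enough to force two indices.
      let α , _ , admissible , q<α = int≥2^-n n (ℤ.+ 1 / suc (2 ^ n)) (1/[1+d]<1/d (2 ^ n) {{ℕ.m^n≢0 2 n}})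
          I , αm≤∣I∣ , ⋀≉𝟘 = admissible (s≤s ℕ.z≤n) v (proj₂ ∘ v∈)
          i , j , i≢j , i∈I , j∈I = two-members I (1/d<α∧αd≤k⇒1<k (2 ^ n) ∣ I ∣ q<α αm≤∣I∣)
      in contradiction
           (⊑𝟘⇒≈𝟘 (⊑-trans (∧-greatest (⋀-⊑ I v i i∈I) (⋀-⊑ I v j j∈I))
             (⊑-reflexive (A-disjoint (proj₁ (v∈ i)) (proj₁ (v∈ j)) (v-distinct i j i≢j)))))
           ⋀≉𝟘

-- The poset of labelled forests

module Forcing (em : ∀ {ℓ} → ExcludedMiddle ℓ) (ac : ∀ {ℓ} → AxiomOfChoice ℓ) (ma : MartinsAxiom)
               (W : StrictTotalOrder 0ℓ 0ℓ 0ℓ) (isOmega₁ : IsOmega₁ W)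
               (W≺𝔠 : StrictTotalOrder.Eq.setoid W ≺ Continuum)
               (𝔅 : BooleanAlgebra 0ℓ 0ℓ) (atomless : Atomless 𝔅)
               (𝔅≺𝔠 : BooleanAlgebra.setoid 𝔅 ≺ Continuum) (ccc : CCC 𝔅)
               (nontrivial : ¬ BooleanAlgebra._≈_ 𝔅 (BooleanAlgebra.⊤ 𝔅) (BooleanAlgebra.⊥ 𝔅))
               where

  open Classical em
  open Omega₁ ac W isOmega₁
  open Order 𝔅
  open Meets 𝔅
  open CCCUnderMA em ac ma W isOmega₁ W≺𝔠 𝔅 ccc
  open StrictTotalOrder W using (module Eq) renaming (Carrier to ∣W∣)

  Halves : Carrier → (Bool → Carrier) → Set
  Halves a h = (∀ b → ¬ h b ≈ 𝟘) × (∀ b → h b ⊑ a) × h false ∧ h true ≈ 𝟘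

  -- As `a` is no atom, some `b ⊑ a` differs from `𝟘` and `a`; the halves are `b` and `a ∧ ∁ b`, the
  -- latter nonzero since otherwise `a ⊑ b`.
  split : ∀ {a} → ¬ a ≈ 𝟘 → ∃ (Halves a)
  split {a} a≉𝟘 = by-contradiction λ unsplit → atomless (a , a≉𝟘 , λ b b≤a →
    by-contradiction λ proper → unsplit
      ( (λ { false → b ; true → a ∧ ∁ b })
      , (λ { false b≈𝟘 → proper (inj₁ b≈𝟘)
           ; true rest≈𝟘 → proper (inj₂ (⊑-antisym b≤a (a∧∁b≈𝟘⇒a⊑b rest≈𝟘))) })
      , (λ { false → b≤a ; true → x∧y≤x _ _ })
      , disjoint-⊑ ⊑-refl (x∧y≤y a (∁ b)) (∧-complementʳ b) ))

  -- Made total by a default at `𝟘`, so that labels can be halved without carrying a proof that they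
  -- are nonzero.
  half : Carrier → Bool → Carrier
  half a with em {P = a ≈ 𝟘}
  ... | yes _   = λ _ → 𝟘
  ... | no  a≉𝟘 = proj₁ (split a≉𝟘)

  half-halves : ∀ {a} → ¬ a ≈ 𝟘 → Halves a (half a)
  half-halves {a} a≉𝟘 with em {P = a ≈ 𝟘}
  ... | yes a≈𝟘 = contradiction a≈𝟘 a≉𝟘
  ... | no  a≉𝟘 = proj₂ (split a≉𝟘)

  -- Halving the remainder repeatedly splits off pairwise disjoint nonzero elements `ι n`, hence an
  -- injection of ℕ into the algebra.
  remainder : ℕ → Carrier
  remainder zero    = 𝟙
  remainder (suc n) = half (remainder n) true

  ι : ℕ → Carrier
  ι n = half (remainder n) false

  remainder≉𝟘 : ∀ n → ¬ remainder n ≈ 𝟘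
  remainder≉𝟘 zero    = nontrivial
  remainder≉𝟘 (suc n) = proj₁ (half-halves (remainder≉𝟘 n)) true

  remainder-antitone : ∀ m {n} → m ≤′ n → remainder n ⊑ remainder m
  remainder-antitone m ≤′-refl = ⊑-refl
  remainder-antitone m {suc n} (≤′-step m≤n) =
    ⊑-trans (proj₁ (proj₂ (half-halves (remainder≉𝟘 n))) true) (remainder-antitone m m≤n)

  ι-disjoint : ∀ {m n} → m < n → ι m ∧ ι n ≈ 𝟘
  ι-disjoint {m} {n} m<n = disjoint-⊑ ⊑-refl
    (⊑-trans (proj₁ (proj₂ (half-halves (remainder≉𝟘 n))) false) (remainder-antitone (suc m) (ℕ.≤⇒≤′ m<n)))
    (proj₂ (proj₂ (half-halves (remainder≉𝟘 m))))

  ι≉𝟘 : ∀ n → ¬ ι n ≈ 𝟘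
  ι≉𝟘 n = proj₁ (half-halves (remainder≉𝟘 n)) false

  ι-injective : ∀ m n → ι m ≈ ι n → m ≡ n
  ι-injective m n eq with ℕ.<-cmp m n
  ... | tri< m<n _ _ = contradiction eq (disjoint⇒≉ (ι≉𝟘 m) (ι-disjoint m<n))
  ... | tri≈ _ m≡n _ = m≡n
  ... | tri> _ _ n<m = contradiction (≈-sym eq) (disjoint⇒≉ (ι≉𝟘 n) (ι-disjoint n<m))

  -- The node w of the binary tree has the children false ∷ w and true ∷ w.
  -- A word containing false lies in one of the countably many trees rooted at
  -- false ∷ true ∷ … ∷ true; the labels of different trees are unrelated.
  record Condition : Set where
    field
      height         : ℕ
      label          : List Bool → Carrier
      label≉𝟘        : ∀ w → length w ≤ height → ¬ label w ≈ 𝟘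
      label-⊑        : ∀ b w → false ∈ᴸ w → length w < height → label (b ∷ w) ⊑ label w
      label-disjoint : ∀ w → false ∈ᴸ w → length w < height → label (false ∷ w) ∧ label (true ∷ w) ≈ 𝟘

  open Condition

  infix 4 _≼_
  -- A stronger condition may be taller and may shrink old labels; the latter lets two conditions be
  -- joined by taking meets.
  record _≼_ (q p : Condition) : Set where
    constructor _,_
    field
      height-≤ : height p ≤ height q
      label-≼  : ∀ w → length w ≤ height p → label q w ⊑ label p w

  open _≼_

  ≼-refl : ∀ {p} → p ≼ p
  ≼-refl = ℕ.≤-refl , λ _ _ → ⊑-refl

  ≼-trans : ∀ {p q r} → p ≼ q → q ≼ r → p ≼ r
  ≼-trans (hq≤hp , p≤q) (hr≤hq , q≤r) = ℕ.≤-trans hr≤hq hq≤hp ,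
    λ w ∣w∣≤ → ⊑-trans (p≤q w (ℕ.≤-trans ∣w∣≤ hr≤hq)) (q≤r w ∣w∣≤)

  conditions : Poset 0ℓ 0ℓ 0ℓ
  conditions = record
    { Carrier        = Condition
    -- Labels beyond the height carry no information and are ignored by this equality.
    ; _≈_            = λ p q → p ≼ q × q ≼ p
    ; _≤_            = _≼_
    ; isPartialOrder = record
      { isPreorder = record
        { isEquivalence = record
          { refl  = ≼-refl , ≼-refl
          ; sym   = swap
          ; trans = λ (p≼q , q≼p) (q≼r , r≼q) → ≼-trans p≼q q≼r , ≼-trans r≼q q≼p
          }
        ; reflexive = proj₁
        ; trans     = ≼-trans
        }
      ; antisym = _,_
      }
    }

  -- The countable chain condition for labelled forests

  Linked : ℕ → (∣W∣ → List Bool → Carrier) → Pred ∣W∣ 0ℓ → Set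
  Linked n F S = ∀ {v w} → S v → S w → ∀ u → length u ≤ n → ¬ F v u ∧ F w u ≈ 𝟘

  -- Property (K) is used once for every word of length at most `n`, each time inside the
  -- uncountable set found before. Peeling off the head merely enumerates the words; in the tree the
  -- head is the last step of a branch.
  linked-subset : ∀ n (F : ∣W∣ → List Bool → Carrier) {S : Pred ∣W∣ 0ℓ} →
    (∀ {w} → S w → ∀ u → length u ≤ n → ¬ F w u ≈ 𝟘) → ¬ Coded (restrict Eq.setoid S) →
    ∃ λ (S′ : Pred ∣W∣ 0ℓ) → (∀ {w} → S′ w → S w) × ¬ Coded (restrict Eq.setoid S′) × Linked n F S′
  linked-subset zero F F≉𝟘 uncoded =
    let S₁ , S₁⊆S , uncoded₁ , linked₁ = k-property (λ w → F w []) (λ s → F≉𝟘 s [] ℕ.z≤n) uncoded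
    in S₁ , S₁⊆S , uncoded₁ , λ { s t [] _ → linked₁ s t }
  linked-subset (suc n) F F≉𝟘 uncoded
    with S₁ , S₁⊆S , uncoded₁ , linked₁ ← k-property (λ w → F w []) (λ s → F≉𝟘 s [] ℕ.z≤n) uncoded
    with S₂ , S₂⊆S₁ , uncoded₂ , linked₂ ← linked-subset n (λ w u → F w (false ∷ u))
           (λ s u ∣u∣≤n → F≉𝟘 (S₁⊆S s) (false ∷ u) (s≤s ∣u∣≤n)) uncoded₁
    with S₃ , S₃⊆S₂ , uncoded₃ , linked₃ ← linked-subset n (λ w u → F w (true ∷ u))
           (λ s u ∣u∣≤n → F≉𝟘 (S₁⊆S (S₂⊆S₁ s)) (true ∷ u) (s≤s ∣u∣≤n)) uncoded₂
    = S₃ , S₁⊆S ∘ S₂⊆S₁ ∘ S₃⊆S₂ , uncoded₃ ,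
      λ { s t []          _            → linked₁ (S₂⊆S₁ (S₃⊆S₂ s)) (S₂⊆S₁ (S₃⊆S₂ t))
        ; s t (false ∷ u) (s≤s ∣u∣≤n) → linked₂ (S₃⊆S₂ s) (S₃⊆S₂ t) u ∣u∣≤n
        ; s t (true  ∷ u) (s≤s ∣u∣≤n) → linked₃ s t u ∣u∣≤n }

  -- Labelwise meets give a common extension: linkedness makes them nonzero, and the order and the
  -- disjointness of siblings pass to meets.
  linked⇒compatible : ∀ p q → height p ≡ height q →
    (∀ w → length w ≤ height p → ¬ label p w ∧ label q w ≈ 𝟘) → Compatible conditions p q
  linked⇒compatible p q hp≡hq linked = r ,
    (ℕ.≤-refl , λ w _ → x∧y≤x _ _) ,
    (ℕ.≤-reflexive (sym hp≡hq) , λ w _ → x∧y≤y _ _)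
    where
    r : Condition
    r = record
      { height         = height p
      ; label          = λ w → label p w ∧ label q w
      ; label≉𝟘        = linked
      ; label-⊑        = λ b w f∈w ∣w∣< →
          ∧-mono (label-⊑ p b w f∈w ∣w∣<) (label-⊑ q b w f∈w (subst (length w <_) hp≡hq ∣w∣<))
      ; label-disjoint = λ w f∈w ∣w∣< →
          disjoint-⊑ (x∧y≤x _ _) (x∧y≤x _ _) (label-disjoint p w f∈w ∣w∣<)
      }

  -- An uncountable antichain yields ω₁ distinct conditions; uncountably many share a height, and
  -- among these `linked-subset` finds two that are compatible.
  conditions-ccc : NoUncountableAntichain conditions
  conditions-ccc (A , incompatible , A-uncountable)
    with e , _ , e-incompatible ← ω₁-sequence (subsetoid A) (λ (p , _) (q , _) → ¬ Poset._≈_ conditions p q)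
           (next-distinct (subsetoid A) (A-uncountable ∘ coded⇒countable))
    with n , n-uncoded ← uncountable-fibre (λ w → height (proj₁ (e w)))
    with S , S⊆ , uncoded , linked ← linked-subset n (λ w → label (proj₁ (e w)))
           (λ {w} ∣ew∣≡n u ∣u∣≤n → label≉𝟘 (proj₁ (e w)) u (subst (length u ≤_) (sym ∣ew∣≡n) ∣u∣≤n)) n-uncoded
    with v , _ , Sv ← uncoded⇒unbounded uncoded ω₁-element
    with w , v<w , Sw ← uncoded⇒unbounded uncoded v
    = incompatible (proj₂ (e v)) (proj₂ (e w)) (e-incompatible v<w)
        (linked⇒compatible (proj₁ (e v)) (proj₁ (e w)) (trans (S⊆ Sv) (sym (S⊆ Sw)))
          λ u ∣u∣≤ → linked Sv Sw u (subst (length u ≤_) (S⊆ Sv) ∣u∣≤))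

  -- Extending conditions, and the dense sets

  spine : ℕ → List Bool
  spine n = replicate n true

  false∉spine : ∀ n → ¬ false ∈ᴸ spine n
  false∉spine (suc n) (there f∈) = false∉spine n f∈

  module Extend (p : Condition) {a : Carrier} (a≉𝟘 : ¬ a ≈ 𝟘) where

    -- On the new level, nodes inside a tree get the halves of their parent's label; the new root,
    -- and the spine word beside it, get `a`.
    child : ∀ b w → Dec (false ∈ᴸ w) → Carrier
    child b w (yes _) = half (label p w) b
    child b w (no  _) = a

    newLabel : ∀ w → Dec (length w ≤ height p) → Carrier
    newLabel w       (yes _) = label p w
    -- The empty word is never longer than the height, so this value is only a default.
    newLabel []      (no  _) = 𝟙
    newLabel (b ∷ w) (no  _) = child b w em

    extLabel : List Bool → Carrier
    extLabel w = newLabel w (length w ℕ.≤? height p)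

    old : ∀ w → length w ≤ height p → extLabel w ≡ label p w
    old w ∣w∣≤ with length w ℕ.≤? height p
    ... | yes _ = refl
    ... | no ∣w∣≰ = contradiction ∣w∣≤ ∣w∣≰

    new : ∀ b w → height p ≤ length w → extLabel (b ∷ w) ≡ child b w em
    new b w h≤ with suc (length w) ℕ.≤? height p
    ... | yes ∣w∣< = contradiction ∣w∣< (ℕ.≤⇒≯ h≤)
    ... | no  _    = refl

    new-inner : ∀ b w → false ∈ᴸ w → height p ≤ length w → extLabel (b ∷ w) ≡ half (label p w) b
    new-inner b w f∈w h≤ = trans (new b w h≤) (child-inner em)
      where
      child-inner : ∀ d → child b w d ≡ half (label p w) b
      child-inner (yes _)   = refl
      child-inner (no  f∉w) = contradiction f∈w f∉w

    new-root : ∀ b w → ¬ false ∈ᴸ w → height p ≤ length w → extLabel (b ∷ w) ≡ a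
    new-root b w f∉w h≤ = trans (new b w h≤) (child-root em)
      where
      child-root : ∀ d → child b w d ≡ a
      child-root (yes f∈w) = contradiction f∈w f∉w
      child-root (no  _)   = refl

    extLabel≉𝟘 : ∀ w → length w ≤ suc (height p) → ¬ extLabel w ≈ 𝟘
    extLabel≉𝟘 w ∣w∣≤ with ℕ.≤-<-connex (length w) (height p)
    ... | inj₁ ∣w∣≤h = subst (λ x → ¬ x ≈ 𝟘) (sym (old w ∣w∣≤h)) (label≉𝟘 p w ∣w∣≤h)
    extLabel≉𝟘 (b ∷ w) (s≤s ∣w∣≤) | inj₂ (s≤s h≤) with em {P = false ∈ᴸ w}
    ... | yes f∈w = subst (λ x → ¬ x ≈ 𝟘) (sym (new-inner b w f∈w h≤))
                      (proj₁ (half-halves (label≉𝟘 p w ∣w∣≤)) b)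
    ... | no  f∉w = subst (λ x → ¬ x ≈ 𝟘) (sym (new-root b w f∉w h≤)) a≉𝟘

    extLabel-⊑ : ∀ b w → false ∈ᴸ w → length w ≤ height p → extLabel (b ∷ w) ⊑ label p w
    extLabel-⊑ b w f∈w ∣w∣≤ with ℕ.<-≤-connex (length w) (height p)
    ... | inj₁ ∣w∣<h = subst (_⊑ label p w) (sym (old (b ∷ w) ∣w∣<h)) (label-⊑ p b w f∈w ∣w∣<h)
    ... | inj₂ h≤    = subst (_⊑ label p w) (sym (new-inner b w f∈w h≤))
                         (proj₁ (proj₂ (half-halves (label≉𝟘 p w ∣w∣≤))) b)

    extLabel-disjoint : ∀ w → false ∈ᴸ w → length w ≤ height p →
                        extLabel (false ∷ w) ∧ extLabel (true ∷ w) ≈ 𝟘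
    extLabel-disjoint w f∈w ∣w∣≤ with ℕ.<-≤-connex (length w) (height p)
    ... | inj₁ ∣w∣<h = subst₂ (λ x y → x ∧ y ≈ 𝟘) (sym (old (false ∷ w) ∣w∣<h)) (sym (old (true ∷ w) ∣w∣<h))
                         (label-disjoint p w f∈w ∣w∣<h)
    ... | inj₂ h≤    = subst₂ (λ x y → x ∧ y ≈ 𝟘) (sym (new-inner false w f∈w h≤)) (sym (new-inner true w f∈w h≤))
                         (proj₂ (proj₂ (half-halves (label≉𝟘 p w ∣w∣≤))))

    extend : Condition
    extend = record
      { height         = suc (height p)
      ; label          = extLabel
      ; label≉𝟘        = extLabel≉𝟘
      ; label-⊑        = λ { b w f∈w (s≤s ∣w∣≤) →
          subst (extLabel (b ∷ w) ⊑_) (sym (old w ∣w∣≤)) (extLabel-⊑ b w f∈w ∣w∣≤) }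
      ; label-disjoint = λ { w f∈w (s≤s ∣w∣≤) → extLabel-disjoint w f∈w ∣w∣≤ }
      }

    extend-≼ : extend ≼ p
    extend-≼ = ℕ.n≤1+n _ , λ w ∣w∣≤ → ⊑-reflexive (≈-reflexive (old w ∣w∣≤))

    -- Spine words lie in no tree; each positive level has exactly one root, obtained by putting
    -- `false` on the spine word one level below.
    root : List Bool
    root = false ∷ spine (height p)

    root-label : extLabel root ⊑ a
    root-label = ⊑-reflexive (≈-reflexive (new-root false (spine (height p)) (false∉spine (height p))
      (ℕ.≤-reflexive (sym (length-replicate (height p))))))

  open Extend using (extend; extend-≼; root; root-label)

  reach : ∀ n p → ∃ λ q → q ≼ p × n ≤ height q
  reach zero    p = p , ≼-refl , ℕ.z≤n
  reach (suc n) p with q , q≼p , n≤ ← reach n p =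
    -- Only the height matters here, so the new root takes the label `𝟙`.
    extend q nontrivial , ≼-trans (extend-≼ q nontrivial) q≼p , s≤s n≤

  Covers : Carrier → Condition → Set
  Covers a p = ∃ λ w → false ∈ᴸ w × length w ≤ height p × label p w ⊑ a

  -- Since 𝔅 indexes the dense sets, the requirement that the height exceed n
  -- is attached to the index ι n.
  D : Carrier → SubsetOf (Poset.Eq.setoid conditions)
  D a = record
    { member = λ p → (¬ a ≈ 𝟘 → Covers a p) × (∀ n → ι n ≈ a → n ≤ height p)
    ; resp   = λ (_ , q≼p) (covers , high) →
        (λ a≉𝟘 → let w , f∈w , ∣w∣≤ , w⊑a = covers a≉𝟘
                 in w , f∈w , ℕ.≤-trans ∣w∣≤ (height-≤ q≼p) , ⊑-trans (label-≼ q≼p w ∣w∣≤) w⊑a) ,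
        λ n ιn≈a → ℕ.≤-trans (high n ιn≈a) (height-≤ q≼p)
    }

  D-cong : ∀ {a b} → a ≈ b → D a ⊆ D b
  D-cong a≈b (covers , high) =
    (λ b≉𝟘 → let w , f∈w , ∣w∣≤ , w⊑a = covers (λ a≈𝟘 → b≉𝟘 (≈-trans (≈-sym a≈b) a≈𝟘))
             in w , f∈w , ∣w∣≤ , ⊑-trans w⊑a (⊑-reflexive a≈b)) ,
    λ n ιn≈b → high n (≈-trans ιn≈b (≈-sym a≈b))

  -- Injectivity of `ι` leaves at most one `n` to satisfy.
  required-height : ∀ a → ∃ λ m → ∀ n → ι n ≈ a → n ≤ m
  required-height a with em {P = ∃ λ n → ι n ≈ a}
  ... | yes (m , ιm≈a) = m , λ n ιn≈a → ℕ.≤-reflexive (ι-injective n m (≈-trans ιn≈a (≈-sym ιm≈a)))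
  ... | no  none       = 0 , λ n ιn≈a → contradiction (n , ιn≈a) none

  -- The condition is first raised to the required height; if `a` is nonzero, one more level adds a
  -- root labelled `a`.
  D-dense : ∀ a → Dense conditions (D a)
  D-dense a p with m , bound ← required-height a
              with q , q≼p , m≤ ← reach m p
              with em {P = a ≈ 𝟘}
  ... | yes a≈𝟘 = q , ((λ a≉𝟘 → contradiction a≈𝟘 a≉𝟘) , λ n ιn≈a → ℕ.≤-trans (bound n ιn≈a) m≤) , q≼p
  ... | no  a≉𝟘 = extend q a≉𝟘 ,
        ( (λ _ → root q a≉𝟘 , here refl , s≤s (ℕ.≤-reflexive (length-replicate (height q))) , root-label q a≉𝟘)
        , λ n ιn≈a → ℕ.≤-trans (bound n ιn≈a) (ℕ.m≤n⇒m≤1+n m≤) ) ,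
        ≼-trans (extend-≼ q a≉𝟘) q≼p

  trivialCondition : Condition
  trivialCondition = record
    { height         = 0
    ; label          = λ _ → 𝟙
    ; label≉𝟘        = λ _ _ → nontrivial
    ; label-⊑        = λ _ _ _ ()
    ; label-disjoint = λ _ _ ()
    }

  -- The decomposition read off a generic filter

  module Generic (G : SubsetOf (Poset.Eq.setoid conditions)) (isFilter : IsFilter conditions G)
                 (meets : ∀ a → ∃ λ p → p ∈ G × p ∈ D a) where
    open IsFilter isFilter

    lower-bound : ∀ {m} (p : Fin m → Condition) → (∀ i → p i ∈ G) → ∃ λ r → r ∈ G × (∀ i → r ≼ p i)
    lower-bound {zero}  p p∈G with r , r∈G ← nonempty = r , r∈G , λ ()
    lower-bound {suc m} p p∈G with q , q∈G , q≼ ← lower-bound (p ∘ suc) (p∈G ∘ suc)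
                              with r , r∈G , r≼p₀ , r≼q ← directed (p∈G zero) q∈G
      = r , r∈G , λ { zero → r≼p₀ ; (suc i) → ≼-trans r≼q (q≼ i) }

    Piece : List Bool → Carrier → Set
    Piece w a = ∃ λ p → p ∈ G × length w ≤ height p × label p w ⊑ a

    piece-upward : ∀ {w a b} → a ⊑ b → Piece w a → Piece w b
    piece-upward a⊑b (p , p∈G , ∣w∣≤ , w⊑a) = p , p∈G , ∣w∣≤ , ⊑-trans w⊑a a⊑b

    𝔅ₙ : ℕ → SubsetOf setoid
    𝔅ₙ n = record
      { member = λ a → ∃ λ w → false ∈ᴸ w × length w ≡ n × Piece w a
      ; resp   = λ a≈b (w , f∈w , ∣w∣≡n , piece) →
          w , f∈w , ∣w∣≡n , piece-upward (⊑-reflexive a≈b) piece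
      }

    𝔅ₙ-split : ∀ n {a} → a ∈ 𝔅ₙ n → ∃ λ (h : Bool → Carrier) →
      (∀ b → h b ∈ 𝔅ₙ (suc n)) × (∀ b → h b ⊑ a) × h false ∧ h true ≈ 𝟘
    𝔅ₙ-split n (w , f∈w , refl , p , p∈G , ∣w∣≤ , w⊑a)
      -- This dense set puts a condition of height at least `suc n` into `G`; a common extension
      -- with `p` then also labels the children of `w`.
      with q , q∈G , _ , high ← meets (ι (suc n))
      with r , r∈G , r≼p , r≼q ← directed p∈G q∈G
      = (λ b → label r (b ∷ w)) ,
        (λ b → b ∷ w , there f∈w , refl , r , r∈G , ∣w∣< , ⊑-refl) ,
        (λ b → ⊑-trans (label-⊑ r b w f∈w ∣w∣<) (⊑-trans (label-≼ r≼p w ∣w∣≤) w⊑a)) ,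
        label-disjoint r w f∈w ∣w∣<
      where
      ∣w∣< : length w < height r
      ∣w∣< = ℕ.≤-trans (high (suc n) ≈-refl) (height-≤ r≼q)

    -- Entries that share the word `w` lie above labels at `w` of conditions in `G`; the label at
    -- `w` of a common extension is a nonzero lower bound.
    𝔅ₙ-admissible : ∀ n → Admissible 𝔅 (𝔅ₙ n) (2^- n)
    𝔅ₙ-admissible n {m} 0<m a a∈ =
      J , m≤k*d⇒m/d≤k m ∣ J ∣ (2 ^ n) {{ℕ.m^n≢0 2 n}} m≤ , meet≉𝟘
      where
      word : Fin m → List Bool
      word = proj₁ ∘ a∈
      majority-word = pigeonhole-words n ⊤ᴵ word (λ i → proj₁ (proj₂ (proj₂ (a∈ i))))
      w = proj₁ majority-word
      J = proj₁ (proj₂ majority-word)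
      J-spec : ∀ i → Vec.lookup J i ≡ true → word i ≡ w
      J-spec i i∈J = proj₂ (proj₂ (proj₂ (proj₂ majority-word)) i i∈J)
      m≤ : m ≤ ∣ J ∣ * 2 ^ n
      m≤ = subst (_≤ ∣ J ∣ * 2 ^ n) (∣⊤∣≡n m) (proj₁ (proj₂ (proj₂ majority-word)))
      0<∣J∣ : 0 < ∣ J ∣
      0<∣J∣ with ∣ J ∣ | m≤
      ... | zero  | m≤0 = contradiction (ℕ.≤-trans 0<m m≤0) λ ()
      ... | suc _ | _   = s≤s ℕ.z≤n
      condition : Fin m → Condition
      condition i = proj₁ (proj₂ (proj₂ (proj₂ (a∈ i))))
      J-piece : ∀ i → Vec.lookup J i ≡ true → length w ≤ height (condition i) × label (condition i) w ⊑ a i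
      J-piece i i∈J = subst (λ u → length u ≤ height (condition i) × label (condition i) u ⊑ a i)
        (J-spec i i∈J) (proj₂ (proj₂ (proj₂ (proj₂ (proj₂ (a∈ i))))))
      meet≉𝟘 : ¬ ⋀ 𝔅 J a ≈ 𝟘
      meet≉𝟘 with r , _ , r≼ ← lower-bound condition (λ i → proj₁ (proj₂ (proj₂ (proj₂ (proj₂ (a∈ i))))))
             -- A member of `J` shows that `w` lies within the height of `r`, where labels are
             -- nonzero.
             with j , j∈J ← member J 0<∣J∣
        = ≉𝟘-upward
            (⋀-greatest J a λ i i∈J → let ∣w∣≤ , w⊑a = J-piece i i∈J in ⊑-trans (label-≼ (r≼ i) w ∣w∣≤) w⊑a)
            (label≉𝟘 r w (ℕ.≤-trans (proj₁ (J-piece j j∈J)) (height-≤ (r≼ j))))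

    isDecomposition : IsDecomposition 𝔅 𝔅ₙ
    isDecomposition = record
      { union      = λ a → mk⇔
          (λ a≉𝟘 → let p , p∈G , covers , _ = meets a
                       w , f∈w , ∣w∣≤ , w⊑a = covers a≉𝟘
                   in length w , w , f∈w , refl , p , p∈G , ∣w∣≤ , w⊑a)
          (λ (_ , w , _ , _ , p , _ , ∣w∣≤ , w⊑a) → ≉𝟘-upward w⊑a (label≉𝟘 p w ∣w∣≤))
      ; increasing = increasing
      ; int≥2^-n   = λ n q q<2^-n → 2^- n , 0≤2^- n , 𝔅ₙ-admissible n , q<2^-n
      ; splitting  = splitting
      }
      where
      -- An element above the label of a node is also above the label of its child.
      increasing : ∀ n → 𝔅ₙ n ⊆ 𝔅ₙ (suc n)
      increasing n a∈ with h , h∈ , h⊑a , _ ← 𝔅ₙ-split n a∈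
                      with w , f∈w , ∣w∣≡ , piece ← h∈ true
        = w , f∈w , ∣w∣≡ , piece-upward (h⊑a true) piece
      splitting : ∀ n {a} → a ∈ 𝔅ₙ n → ∃ λ b → ∃ λ c →
        b ∈ 𝔅ₙ (suc n) × c ∈ 𝔅ₙ (suc n) × Disjoint 𝔅 b c × b ∨ c ⊑ a
      splitting n a∈ with h , h∈ , h⊑a , disjoint ← 𝔅ₙ-split n a∈
        = h false , h true , h∈ false , h∈ true , disjoint , ∨-least (h⊑a false) (h⊑a true)

  decomposition : ∃ (IsDecomposition 𝔅)
  decomposition with G , isFilter , meets ← ma conditions trivialCondition conditions-ccc setoid 𝔅≺𝔠 D
                       (λ a≈b {p} → D-cong a≈b {p}) D-dense
    = _ , Generic.isDecomposition G isFilter meets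

theorem4p3 : (∀ {ℓ} → ExcludedMiddle ℓ) →
    (∀ {ℓ} → AxiomOfChoice ℓ) →
    MartinsAxiom →
    ¬CH →
    (𝔅 : BooleanAlgebra 0ℓ 0ℓ) →
    Atomless 𝔅 →
    BooleanAlgebra.setoid 𝔅 ≺ Continuum →
    CCC 𝔅 ⇔ ∃ (IsDecomposition 𝔅)
theorem4p3 em ac ma (W , isOmega₁ , W≺𝔠) 𝔅 atomless 𝔅≺𝔠 =
  mk⇔ ccc⇒decomposition (Converse.decomposition⇒ccc em 𝔅)
  where
  open Order 𝔅
  ccc⇒decomposition : CCC 𝔅 → ∃ (IsDecomposition 𝔅)
  ccc⇒decomposition ccc with em {P = 𝟙 ≈ 𝟘}
  ... | no  nontrivial = Forcing.decomposition em ac ma W isOmega₁ W≺𝔠 𝔅 atomless 𝔅≺𝔠 ccc nontrivial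
  -- The one-element algebra has no nonzero elements, so all pieces are empty; admissibility is
  -- vacuous because a sequence of positive length would have an entry in the empty set.
  ... | yes 𝟙≈𝟘        = (λ _ → record { member = λ _ → ⊥ ; resp = λ _ () }) , record
        { union      = λ a → mk⇔ (λ a≉𝟘 → contradiction (⊑𝟘⇒≈𝟘 (⊑-trans ⊑-𝟙 (⊑-reflexive 𝟙≈𝟘))) a≉𝟘) λ ()
        ; increasing = λ _ ()
        ; int≥2^-n   = λ n q q<2^-n → 2^- n , 0≤2^- n ,
            (λ 0<m a a∈ → ⊥-elim (a∈ (Fin.fromℕ< 0<m))) , q<2^-n
        ; splitting  = λ _ ()
        }
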